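{- Distances can be maintained in $\mathrm{DynFOLL}$ under insertions and deletions of $\mathrm{polylog}(n)$ edges for (a) undirected graphs, and (b) acyclic directed graphs. That is, in both cases there is a $\mathrm{DynFOLL}$ program maintaining the relation containing all triples $(u,v,d)$ such that a shortest path from $u$ to $v$ in the current graph has exactly $d$ edges.
   Context: Dynamic complexity setting. All structures have domain $\{0,\dots,n-1\}$ with linear order; numbers $d<n$ are domain elements. Changes insert or delete a set of at most $(\log n)^c$ edges at once (for an arbitrary fixed constant $c$); in case (b) the graph stays acyclic. A dynamic program stores auxiliary relations over the same domain; for each auxiliary relation and change operation it has an update program which, evaluated on the changed input with the old auxiliary relations, defines the new auxiliary relation. The initial input is empty and initial auxiliary relations are first-order definable from it. The program maintains a query if after every sequence of allowed changes from the empty input a designated auxiliary relation equals the query result on the current input. $\mathrm{DynFOLL}$: update programs are DLOGTIME-uniform polynomial-size circuits of depth $O(\log\log n)$ with NOT gates and unbounded fan-in AND/OR gates, equivalently a first-order formula with $\leq,+,\times$ iterated $O(\log\log n)$ times. -}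

module Defs where

open import Data.Nat using (ℕ; zero; suc; _+_; _*_; _^_; _≤_; _≡ᵇ_; _≤ᵇ_)
open import Data.Nat.Logarithm using (⌈log₂_⌉)
open import Data.Bool using (Bool; true; false; _∧_; _∨_; not; T)
open import Data.Fin using (Fin; toℕ; zero; suc)
open import Data.Vec using (Vec; []; _∷_; lookup; map)
open import Data.List using (List; []; _∷_; length; allFin)
open import Data.Bool.ListAction using (any; all)
open import Data.Product using (Σ; _×_; _,_; proj₁; proj₂)
open import Data.Unit using (⊤)
open import Relation.Nullary using (¬_)
open import Function using (_⇔_)

Rel : ℕ → ℕ → Set
Rel n k = Vec (Fin n) k → Bool

-- First-order formulas with m free variables (de Bruijn; variable 0 is the
-- innermost bound one) over relation symbols S with arities ar,
-- plus the built-in numerical predicates =, ≤, + (ternary), × (ternary).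
data Formula (S : Set) (ar : S → ℕ) (m : ℕ) : Set where
  rel    : (s : S) → Vec (Fin m) (ar s) → Formula S ar m
  eqF    : Fin m → Fin m → Formula S ar m
  leqF   : Fin m → Fin m → Formula S ar m
  plusF  : Fin m → Fin m → Fin m → Formula S ar m
  timesF : Fin m → Fin m → Fin m → Formula S ar m
  notF   : Formula S ar m → Formula S ar m
  andF   : Formula S ar m → Formula S ar m → Formula S ar m
  orF    : Formula S ar m → Formula S ar m → Formula S ar m
  exF    : Formula S ar (suc m) → Formula S ar m
  allF   : Formula S ar (suc m) → Formula S ar m

Structure : (S : Set) → (S → ℕ) → ℕ → Set
Structure S ar n = (s : S) → Rel n (ar s)

eval : ∀ {S ar m n} → Formula S ar m → Structure S ar n → Vec (Fin n) m → Bool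
eval (rel s xs) 𝔄 ρ = 𝔄 s (map (λ x → lookup ρ x) xs)
eval (eqF x y) 𝔄 ρ = toℕ (lookup ρ x) ≡ᵇ toℕ (lookup ρ y)
eval (leqF x y) 𝔄 ρ = toℕ (lookup ρ x) ≤ᵇ toℕ (lookup ρ y)
eval (plusF x y z) 𝔄 ρ = (toℕ (lookup ρ x) + toℕ (lookup ρ y)) ≡ᵇ toℕ (lookup ρ z)
eval (timesF x y z) 𝔄 ρ = (toℕ (lookup ρ x) * toℕ (lookup ρ y)) ≡ᵇ toℕ (lookup ρ z)
eval (notF φ) 𝔄 ρ = not (eval φ 𝔄 ρ)
eval (andF φ ψ) 𝔄 ρ = eval φ 𝔄 ρ ∧ eval ψ 𝔄 ρ
eval (orF φ ψ) 𝔄 ρ = eval φ 𝔄 ρ ∨ eval ψ 𝔄 ρ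
eval {n = n} (exF φ) 𝔄 ρ = any (λ a → eval φ 𝔄 (a ∷ ρ)) (allFin n)
eval {n = n} (allF φ) 𝔄 ρ = all (λ a → eval φ 𝔄 (a ∷ ρ)) (allFin n)

Graph : ℕ → Set
Graph n = Fin n → Fin n → Bool

emptyG : ∀ {n} → Graph n
emptyG _ _ = false

edgeRel : ∀ {n} → Graph n → Rel n 2
edgeRel G (x ∷ y ∷ []) = G x y

data Walk {n : ℕ} (G : Graph n) : Fin n → Fin n → ℕ → Set where
  here : ∀ {u} → Walk G u u 0
  step : ∀ {u w v k} → T (G u w) → Walk G w v k → Walk G u v (suc k)

Acyclic : ∀ {n} → Graph n → Set
Acyclic {n} G = ∀ (v : Fin n) k → ¬ Walk G v v (suc k)

IsDist : ∀ {n} → Graph n → Fin n → Fin n → Fin n → Set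
IsDist G u v d = Walk G u v (toℕ d) × (∀ k → Walk G u v k → toℕ d ≤ k)

data Mode : Set where
  undirected dag : Mode

data Kind : Set where
  ins del : Kind

Change : ℕ → Set
Change n = Kind × List (Fin n × Fin n)

_=ᶠ_ : ∀ {n} → Fin n → Fin n → Bool
x =ᶠ y = toℕ x ≡ᵇ toℕ y

memb : ∀ {n} → Fin n → Fin n → List (Fin n × Fin n) → Bool
memb x y [] = false
memb x y ((a , b) ∷ ps) = (x =ᶠ a ∧ y =ᶠ b) ∨ memb x y ps

changeG : ∀ {n} → Mode → List (Fin n × Fin n) → Graph n
changeG undirected Δ x y = memb x y Δ ∨ memb y x Δ
changeG dag Δ x y = memb x y Δ

applyKind : ∀ {n} → Kind → Graph n → Graph n → Graph n
applyKind ins G D x y = G x y ∨ D x y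
applyKind del G D x y = G x y ∧ not (D x y)

applyG : ∀ {n} → Mode → Graph n → Change n → Graph n
applyG m G (k , Δ) = applyKind k G (changeG m Δ)

ModeOK : ∀ {n} → Mode → Graph n → Set
ModeOK undirected G = ⊤
ModeOK dag G = Acyclic G

AllowedFrom : ∀ {n} → Mode → ℕ → Graph n → List (Change n) → Set
AllowedFrom m c G [] = ⊤
AllowedFrom {n} m c G (ch ∷ chs) =
  (length (proj₂ ch) ≤ ⌈log₂ n ⌉ ^ c) × ModeOK m (applyG m G ch) × AllowedFrom m c (applyG m G ch) chs

data ISym : Set where
  iE : ISym

iar : ISym → ℕ
iar iE = 2

istr : ∀ {n} → Graph n → Structure ISym iar n
istr G iE = edgeRel G

-- Symbols available to update formulas: new input E, change set Δ,
-- old auxiliary relations, and the relation R being iterated.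
data USym (σ : List ℕ) (r : ℕ) : Set where
  uE uΔ : USym σ r
  uAux : Fin (length σ) → USym σ r
  uR : USym σ r

uar : ∀ {σ r} → USym σ r → ℕ
uar uE = 2
uar uΔ = 2
uar {σ} (uAux i) = Data.List.lookup σ i
uar {r = r} uR = r

AuxState : List ℕ → ℕ → Set
AuxState σ n = (i : Fin (length σ)) → Rel n (Data.List.lookup σ i)

ustr : ∀ {σ r n} → Graph n → Graph n → AuxState σ n → Rel n r → Structure (USym σ r) uar n
ustr G D A R uE = edgeRel G
ustr G D A R uΔ = edgeRel D
ustr G D A R (uAux i) = A i
ustr G D A R uR = R

-- An update program for a k-ary auxiliary relation: an r-ary relation R
-- is defined by iterating stepF (starting from R = ∅) exactly
-- iCount * (⌈log₂ ⌈log₂ n⌉⌉ + 1) = O(log log n) times, and the new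
-- auxiliary relation is then defined by finalF.
record Update (σ : List ℕ) (k : ℕ) : Set where
  field
    iArity : ℕ
    iCount : ℕ
    stepF  : Formula (USym σ iArity) uar iArity
    finalF : Formula (USym σ iArity) uar k

iterations : ℕ → ℕ → ℕ
iterations cnt n = cnt * (⌈log₂ ⌈log₂ n ⌉ ⌉ + 1)

runUpdate : ∀ {σ k n} → Update σ k → Graph n → Graph n → AuxState σ n → Rel n k
runUpdate {σ} {k} {n} U G D A = eval finalF (ustr G D A (iter (iterations iCount n)))
  where
  open Update U
  iter : ℕ → Rel n iArity
  iter zero _ = false
  iter (suc j) = eval stepF (ustr G D A (iter j))

-- Auxiliary vocabulary: the designated ternary answer relation (index 0)
-- followed by further relations of arities `rest`.
voc : List ℕ → List ℕ
voc rest = 3 ∷ rest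

record DynProg : Set where
  field
    rest  : List ℕ
    initF : (i : Fin (length (voc rest))) → Formula ISym iar (Data.List.lookup (voc rest) i)
    insU  : (i : Fin (length (voc rest))) → Update (voc rest) (Data.List.lookup (voc rest) i)
    delU  : (i : Fin (length (voc rest))) → Update (voc rest) (Data.List.lookup (voc rest) i)

module _ (P : DynProg) where
  open DynProg P

  State : ℕ → Set
  State n = Graph n × AuxState (voc rest) n

  initState : ∀ {n} → State n
  initState = emptyG , λ i → eval (initF i) (istr emptyG)

  chooseU : Kind → (i : Fin (length (voc rest))) → Update (voc rest) (Data.List.lookup (voc rest) i)
  chooseU ins = insU
  chooseU del = delU

  stepP : ∀ {n} → Mode → State n → Change n → State n
  stepP m (G , A) (k , Δ) =
    let G' = applyG m G (k , Δ) in
    G' , λ i → runUpdate (chooseU k i) G' (changeG m Δ) A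

  runP : ∀ {n} → Mode → State n → List (Change n) → State n
  runP m s [] = s
  runP m s (ch ∷ chs) = runP m (stepP m s ch) chs

  MaintainsDist : Mode → ℕ → Set
  MaintainsDist m c =
    ∀ n (chs : List (Change n)) → AllowedFrom m c emptyG chs →
    ∀ (u v d : Fin n) →
      T (proj₂ (runP m initState chs) zero (u ∷ v ∷ d ∷ []))
        ⇔ IsDist (proj₁ (runP m initState chs)) u v d

{-# OPTIONS --safe #-}

-- A shortest walk W of the new graph is cut into pieces that are single edges or
-- have their distance already in the old graph, realised (for deletions) only
-- by walks avoiding the change; the latter is first-order, because a pair (a , b)
-- lies on a shortest walk from u to v iff dist(u,a) + 1 + dist(b,v) = dist(u,v).
-- If W has at most polylog(n) pieces, O(log log n) rounds of doubling find it.
-- To bound the number of pieces, cut greedily and colour every bad interval of W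
-- by edges of the change. Two disjoint bad intervals [i,j] and [i',j'] never
-- share a colour:
--   insertions:          W would use an inserted edge twice and could be shortened;
--   deletions, acyclic:  the shared edge would lie on a cycle of the old graph;
--   deletions, undirected, colour = (first, last) deleted edge on an old shortest
--   walk: the surviving initial segments join i to i', the final ones join j to j',
--   and in total they are shorter than |W[i,j]| + |W[i',j']| ≤ |W[i,i']| + |W[j,j']|,
--   so W could be shortened.
module Submission where

open import Defs
open import Data.Nat
open import Data.Nat.Properties
open import Data.Nat.Logarithm using (⌈log₂_⌉)
open import Data.Nat.Logarithm.Core using (⌈log2⌉)
open import Data.Nat.Induction using (<-wellFounded)
open import Data.Nat.Tactic.RingSolver using (solve-∀)
open import Data.Bool using (true; false; T; not)
open import Data.Bool.Properties using (T-∧; T-∨; T?)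
open import Data.Fin using (Fin; zero; suc; toℕ; fromℕ<; combine)
open import Data.Fin.Properties using (any?; toℕ-injective; toℕ-fromℕ<; toℕ<n; pigeonhole; combine-injective)
import Data.Fin.Properties as Fin
open import Data.Vec as Vec using (Vec; []; _∷_)
open import Data.List as List using (List; []; _∷_; length; allFin; _++_; map)
open import Data.List.Properties using (length-++; length-map)
open import Data.List.Relation.Unary.Any as Any using (here; there)
open import Data.List.Relation.Unary.Any.Properties using (any⁺; any⁻; lookup-index)
import Data.List.Relation.Unary.All as All
open import Data.List.Relation.Unary.All.Properties using (all⁺; all⁻)
open import Data.List.Membership.Propositional using (_∈_; lose)
open import Data.List.Membership.Propositional.Properties using (∈-allFin; ∈-++⁺ˡ; ∈-++⁺ʳ; ∈-map⁺)
open import Data.Product using (Σ; ∃; ∃₂; _×_; _,_; proj₁; proj₂; swap)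
open import Data.Sum as Sum using (_⊎_; inj₁; inj₂)
open import Data.Empty using (⊥; ⊥-elim)
open import Function using (_⇔_; mk⇔; Equivalence; _∘_)
open import Induction.WellFounded using (Acc; acc)
open import Relation.Nullary using (¬_; Dec; yes; no)
open import Relation.Nullary.Decidable using (_×-dec_; map′)
open import Relation.Binary.PropositionalEquality using (_≡_; refl; sym; trans; cong; cong₂; subst; subst₂)

open Equivalence using (to; from)

-- Semantics of formulas in types

sat : ∀ {S ar m n} → Formula S ar m → Structure S ar n → Vec (Fin n) m → Set
sat (rel s xs) 𝔄 ρ = T (𝔄 s (Vec.map (Vec.lookup ρ) xs))
sat (eqF x y) 𝔄 ρ = toℕ (Vec.lookup ρ x) ≡ toℕ (Vec.lookup ρ y)
sat (leqF x y) 𝔄 ρ = toℕ (Vec.lookup ρ x) ≤ toℕ (Vec.lookup ρ y)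
sat (plusF x y z) 𝔄 ρ = toℕ (Vec.lookup ρ x) + toℕ (Vec.lookup ρ y) ≡ toℕ (Vec.lookup ρ z)
sat (timesF x y z) 𝔄 ρ = toℕ (Vec.lookup ρ x) * toℕ (Vec.lookup ρ y) ≡ toℕ (Vec.lookup ρ z)
sat (notF φ) 𝔄 ρ = ¬ sat φ 𝔄 ρ
sat (andF φ ψ) 𝔄 ρ = sat φ 𝔄 ρ × sat ψ 𝔄 ρ
sat (orF φ ψ) 𝔄 ρ = sat φ 𝔄 ρ ⊎ sat ψ 𝔄 ρ
sat (exF φ) 𝔄 ρ = ∃ λ a → sat φ 𝔄 (a ∷ ρ)
sat (allF φ) 𝔄 ρ = ∀ a → sat φ 𝔄 (a ∷ ρ)

T-not : ∀ {b} → T (not b) ⇔ (¬ T b)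
T-not {false} = mk⇔ (λ _ ()) _
T-not {true}  = mk⇔ (λ ()) (λ ¬t → ¬t _)

eval⇔sat : ∀ {S ar m n} (φ : Formula S ar m) (𝔄 : Structure S ar n) ρ → T (eval φ 𝔄 ρ) ⇔ sat φ 𝔄 ρ
eval⇔sat (rel s xs) 𝔄 ρ = mk⇔ (λ t → t) (λ t → t)
eval⇔sat (eqF x y) 𝔄 ρ = mk⇔ (≡ᵇ⇒≡ _ _) (≡⇒≡ᵇ _ _)
eval⇔sat (leqF x y) 𝔄 ρ = mk⇔ (≤ᵇ⇒≤ _ _) ≤⇒≤ᵇ
eval⇔sat (plusF x y z) 𝔄 ρ = mk⇔ (≡ᵇ⇒≡ _ _) (≡⇒≡ᵇ _ _)
eval⇔sat (timesF x y z) 𝔄 ρ = mk⇔ (≡ᵇ⇒≡ _ _) (≡⇒≡ᵇ _ _)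
eval⇔sat (notF φ) 𝔄 ρ = mk⇔
  (λ t s → to T-not t (from (eval⇔sat φ 𝔄 ρ) s))
  (λ ¬s → from T-not (¬s ∘ to (eval⇔sat φ 𝔄 ρ)))
eval⇔sat (andF φ ψ) 𝔄 ρ = mk⇔
  (λ t → let (a , b) = to T-∧ t in to (eval⇔sat φ 𝔄 ρ) a , to (eval⇔sat ψ 𝔄 ρ) b)
  (λ (a , b) → from T-∧ (from (eval⇔sat φ 𝔄 ρ) a , from (eval⇔sat ψ 𝔄 ρ) b))
eval⇔sat (orF φ ψ) 𝔄 ρ = mk⇔
  (λ t → Sum.map (to (eval⇔sat φ 𝔄 ρ)) (to (eval⇔sat ψ 𝔄 ρ)) (to T-∨ t))
  (λ s → from T-∨ (Sum.map (from (eval⇔sat φ 𝔄 ρ)) (from (eval⇔sat ψ 𝔄 ρ)) s))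
eval⇔sat {n = n} (exF φ) 𝔄 ρ = mk⇔
  (λ t → let (a , h) = Any.satisfied (any⁻ _ (allFin n) t) in a , to (eval⇔sat φ 𝔄 (a ∷ ρ)) h)
  (λ (a , s) → any⁺ _ (lose (∈-allFin a) (from (eval⇔sat φ 𝔄 (a ∷ ρ)) s)))
eval⇔sat {n = n} (allF φ) 𝔄 ρ = mk⇔
  (λ t a → to (eval⇔sat φ 𝔄 (a ∷ ρ)) (All.lookup (all⁺ _ (allFin n) t) (∈-allFin a)))
  (λ s → all⁻ _ (All.universal (λ a → from (eval⇔sat φ 𝔄 (a ∷ ρ)) (s a)) (allFin n)))

module _ {σ k n} (U : Update σ k) (G D : Graph n) (A : AuxState σ n) where
  open Update U

  -- The iteration inside runUpdate is a local function that cannot be named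
  -- from here; it is recovered as the solution of the unification problem
  -- posed by runUpdate≡.
  mutual
    iterate : ℕ → Rel n iArity
    iterate = _

    runUpdate≡ : ∀ ρ → runUpdate U G D A ρ ≡ eval finalF (ustr G D A (iterate (iterations iCount n))) ρ
    -- Generalising the number of rounds to a variable `N` makes the unification problem a pattern,
    -- so that it has a unique solution.
    runUpdate≡ ρ with iterations iCount n
    ... | N = refl {x = eval finalF (ustr G D A (iterate N)) ρ}

-- Walks and shortest walks

module _ {n : ℕ} where

  _⊆ᴳ_ : Graph n → Graph n → Set
  H ⊆ᴳ G = ∀ x y → T (H x y) → T (G x y)

  Symmetric : Graph n → Set
  Symmetric G = ∀ x y → T (G x y) → T (G y x)

  IsDistℕ : Graph n → Fin n → Fin n → ℕ → Set
  IsDistℕ G u v k = Walk G u v k × (∀ l → Walk G u v l → k ≤ l)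

  weaken : ∀ {H G u v k} → H ⊆ᴳ G → Walk H u v k → Walk G u v k
  weaken H⊆G here = here
  weaken H⊆G (step e w) = step (H⊆G _ _ e) (weaken H⊆G w)

  infixr 5 _⁀_
  _⁀_ : ∀ {G : Graph n} {u v x k l} → Walk G u v k → Walk G v x l → Walk G u x (k + l)
  here ⁀ w' = w'
  step e w ⁀ w' = step e (w ⁀ w')

  relen : ∀ {G : Graph n} {u v k l} → k ≡ l → Walk G u v k → Walk G u v l
  relen refl w = w

  reverse : ∀ {G u v k} → Symmetric G → Walk G u v k → Walk G v u k
  reverse s here = here
  reverse s (step {k = k} e w) = relen (+-comm k 1) (reverse s w ⁀ step (s _ _ e) here)

  walk? : ∀ G u v k → Dec (Walk {n} G u v k)
  walk? G u v zero = map′ (λ { refl → here }) (λ { here → refl }) (u Fin.≟ v)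
  walk? G u v (suc k) = map′ (λ (_ , e , w) → step e w) (λ { (step e w) → _ , e , w })
    (any? (λ x → T? (G u x) ×-dec walk? G x v k))

  least : (P : ℕ → Set) → (∀ k → Dec (P k)) → ∀ k → P k → ∃ λ l → l ≤ k × P l × (∀ l' → P l' → l ≤ l')
  least P P? zero p = zero , z≤n , p , λ _ _ → z≤n
  least P P? (suc k) p with P? zero
  ... | yes p₀ = zero , z≤n , p₀ , λ _ _ → z≤n
  ... | no ¬p₀ with least (P ∘ suc) (P? ∘ suc) k p
  ... | l , l≤k , pl , min = suc l , s≤s l≤k , pl , λ { zero p₀ → ⊥-elim (¬p₀ p₀) ; (suc l') p' → s≤s (min l' p') }

  shortest : ∀ {G u v k} → Walk G u v k → ∃ λ l → l ≤ k × IsDistℕ G u v l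
  shortest {G} {u} {v} w = least (Walk G u v) (walk? G u v) _ w

  -- A shorter middle part, spliced between the two outer walks, would undercut the lower bound on
  -- walks from `x` to `y`.
  isDistℕ-middle : ∀ {G x a b y p m q} → Walk G x a p → Walk G a b m → Walk G b y q →
    (∀ l → Walk G x y l → p + (m + q) ≤ l) → IsDistℕ G a b m
  isDistℕ-middle {p = p} {m} {q} w₁ w w₂ min = w , λ l w' →
    +-cancelʳ-≤ q m l (+-cancelˡ-≤ p (m + q) (l + q) (min _ (w₁ ⁀ w' ⁀ w₂)))

  -- For a deletion `H` is the old graph and `K` the new one; for an insertion the roles are
  -- exchanged.
  module _ {H K D : Graph n} (split : ∀ x y → T (H x y) → T (K x y) ⊎ T (D x y)) where

    firstHit : ∀ {x y k} → Walk H x y k → Walk K x y k ⊎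
      (∃₂ λ a b → ∃₂ λ p q → Walk K x a p × T (H a b) × T (D a b) × Walk H b y q × p + suc q ≡ k)
    firstHit here = inj₁ here
    firstHit (step {u} {w} e r) with split _ _ e
    ... | inj₂ d = inj₂ (u , w , 0 , _ , here , e , d , r , refl)
    ... | inj₁ e' with firstHit r
    ... | inj₁ r' = inj₁ (step e' r')
    ... | inj₂ (a , b , p , q , w₁ , h , d , w₂ , eq) = inj₂ (a , b , suc p , q , step e' w₁ , h , d , w₂ , cong suc eq)

    lastHit : ∀ {x y k} → Walk H x y k → Walk K x y k ⊎
      (∃₂ λ a b → ∃₂ λ p q → Walk H x a p × T (H a b) × T (D a b) × Walk K b y q × p + suc q ≡ k)
    lastHit here = inj₁ here
    lastHit (step {u} {w} e r) with lastHit r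
    ... | inj₂ (a , b , p , q , w₁ , h , d , w₂ , eq) = inj₂ (a , b , suc p , q , step e w₁ , h , d , w₂ , cong suc eq)
    ... | inj₁ r' with split _ _ e
    ... | inj₁ e' = inj₁ (step e' r')
    ... | inj₂ d = inj₂ (u , w , 0 , _ , here , e , d , r' , refl)

  -- Positions past the end yield the last vertex.
  at : ∀ {G : Graph n} {u v k} → Walk G u v k → ℕ → Fin n
  at (here {u}) i = u
  at (step {u} e w) zero = u
  at (step e w) (suc i) = at w i

  at-start : ∀ {G : Graph n} {u v k} (w : Walk G u v k) → at w 0 ≡ u
  at-start here = refl
  at-start (step e w) = refl

  at-end : ∀ {G : Graph n} {u v k} (w : Walk G u v k) → at w k ≡ v
  at-end here = refl
  at-end (step e w) = at-end w

  section : ∀ {G : Graph n} {u v k} (w : Walk G u v k) i j → i ≤ j → j ≤ k → Walk G (at w i) (at w j) (j ∸ i)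
  section here zero .zero _ z≤n = here
  section (step e w) zero zero _ _ = here
  section (step e w) zero (suc j) _ (s≤s j≤k) =
    step e (subst (λ x → Walk _ x (at w j) j) (at-start w) (section w 0 j z≤n j≤k))
  section (step e w) (suc i) (suc j) (s≤s i≤j) (s≤s j≤k) = section w i j i≤j j≤k

  module ShortestWalk {G : Graph n} {u v d} (w : Walk G u v d) (min : ∀ l → Walk G u v l → d ≤ l) where

    section-isDist : ∀ i j → i ≤ j → j ≤ d → IsDistℕ G (at w i) (at w j) (j ∸ i)
    section-isDist i j i≤j j≤d = isDistℕ-middle
      (section w 0 i z≤n (≤-trans i≤j j≤d)) (section w i j i≤j j≤d) (section w j d j≤d ≤-refl)
      (λ l w' → subst (_≤ l) (sym total) (min l (subst₂ (λ x y → Walk G x y l) (at-start w) (at-end w) w')))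
      where
      total : i + ((j ∸ i) + (d ∸ j)) ≡ d
      total = trans (sym (+-assoc i (j ∸ i) (d ∸ j)))
        (trans (cong (_+ (d ∸ j)) (m+[n∸m]≡n i≤j)) (m+[n∸m]≡n j≤d))

    -- The inequality that every shortcut has to respect, in a form free of truncated subtraction.
    gap : ∀ i j → i ≤ j → j ≤ d → ∀ {l} → Walk G (at w i) (at w j) l → j ≤ i + l
    gap i j i≤j j≤d {l} w' = ≤-trans (≤-reflexive (sym (m+[n∸m]≡n i≤j)))
      (+-monoʳ-≤ i (proj₂ (section-isDist i j i≤j j≤d) l w'))

-- Cutting a walk into few pieces

-- Pieces may be empty, so that for reflexive `Q` exactly `m` pieces can stand for at most `m`.
data Cuts (Q : ℕ → ℕ → Set) : ℕ → ℕ → ℕ → Set where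
  nil  : ∀ {i} → Cuts Q 0 i i
  cons : ∀ {m i j k} → i ≤ j → Q i j → Cuts Q m j k → Cuts Q (suc m) i k

cuts-split : ∀ {Q} m {m' i k} → Cuts Q (m + m') i k → ∃ λ j → i ≤ j × Cuts Q m i j × Cuts Q m' j k
cuts-split zero cs = _ , ≤-refl , nil , cs
cuts-split (suc m) (cons i≤j q cs) =
  let (j' , j≤j' , cs₁ , cs₂) = cuts-split m cs in j' , ≤-trans i≤j j≤j' , cons i≤j q cs₁ , cs₂

cuts-≤ : ∀ {Q m i k} → Cuts Q m i k → i ≤ k
cuts-≤ nil = ≤-refl
cuts-≤ (cons i≤j _ cs) = ≤-trans i≤j (cuts-≤ cs)

cuts-pad : ∀ {Q} → (∀ i → Q i i) → ∀ {m m' i k} → m ≤ m' → Cuts Q m i k → Cuts Q m' i k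
cuts-pad {Q} Q-refl {m} {m'} {i} {k} m≤m' cs =
  subst (λ x → Cuts Q x i k) (m∸n+n≡m m≤m') (go (m' ∸ m))
  where
  go : ∀ x → Cuts Q (x + m) i k
  go zero = cs
  go (suc x) = cons ≤-refl (Q-refl _) (go x)

-- Cutting greedily at the first coloured interval stops after at most as many
-- rounds as there are colours.
module Cutting
  (d k : ℕ) (Q : ℕ → ℕ → Set) (Has : ℕ → ℕ → Fin k × Fin k → Set)
  (Q-refl : ∀ i → Q i i) (Q-step : ∀ i → i < d → Q i (suc i))
  (cover : ∀ i j → i ≤ j → j ≤ d → Q i j ⊎ ∃ (Has i j))
  (distinct : ∀ {i j i' j'} c → i ≤ j → j ≤ i' → i' ≤ j' → j' ≤ d → Has i j c → Has i' j' c → ⊥)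
  where

  data Seq : ℕ → ℕ → Set where
    []  : ∀ {i} → Seq 0 i
    add : ∀ {r i j} c → i ≤ j → j ≤ d → Has i j c → Seq r j → Seq (suc r) i

  colour : ∀ {r i} → Seq r i → Fin r → Fin k × Fin k
  colour (add c _ _ _ s) zero = c
  colour (add _ _ _ _ s) (suc a) = colour s a

  interval : ∀ {r i} (s : Seq r i) a → ∃₂ λ i' j' → i ≤ i' × i' ≤ j' × j' ≤ d × Has i' j' (colour s a)
  interval (add c i≤j j≤d h s) zero = _ , _ , ≤-refl , i≤j , j≤d , h
  interval (add c i≤j j≤d h s) (suc a) =
    let (i' , j' , j≤i' , rest) = interval s a in i' , j' , ≤-trans i≤j j≤i' , rest

  colours-distinct : ∀ {r i} (s : Seq r i) {a b} → toℕ a < toℕ b → ¬ (colour s a ≡ colour s b)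
  colours-distinct (add c i≤j j≤d h s) {zero} {suc b} _ eq =
    let (i' , j' , j≤i' , i'≤j' , j'≤d , h') = interval s b
    in distinct c i≤j j≤i' i'≤j' j'≤d h (subst (Has i' j') (sym eq) h')
  colours-distinct (add c i≤j j≤d h s) {suc a} {suc b} (s≤s a<b) eq = colours-distinct s a<b eq

  no-long-seq : ∀ {i} → ¬ Seq (suc (k * k)) i
  no-long-seq s =
    let (a , b , a<b , eq) = pigeonhole (n<1+n (k * k)) (λ a → combine (proj₁ (colour s a)) (proj₂ (colour s a)))
        (eq₁ , eq₂) = combine-injective _ _ _ _ eq
    in colours-distinct s a<b (cong₂ _,_ eq₁ eq₂)

  -- The fuel `f` counts the positions still to be tried. Along with a coloured interval comes the
  -- good interval one edge shorter, which becomes a piece of the cut.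
  firstBad : ∀ f i j → i ≤ j → f + j ≡ d → Q i j →
    Q i d ⊎ ∃ λ j' → i ≤ j' × j' < d × Q i j' × ∃ (Has i (suc j'))
  firstBad zero i j i≤j refl q = inj₁ q
  firstBad (suc f) i j i≤j eq q with cover i (suc j) (m≤n⇒m≤1+n i≤j) (m+n≤o⇒n≤o f (≤-reflexive (trans (+-suc f j) eq)))
  ... | inj₁ q' = firstBad f i (suc j) (m≤n⇒m≤1+n i≤j) (trans (+-suc f j) eq) q'
  ... | inj₂ h = inj₂ (j , i≤j , m+n≤o⇒n≤o f (≤-reflexive (trans (+-suc f j) eq)) , q , h)

  -- Each round yields one coloured interval and costs two pieces, a good interval and the edge that
  -- spoils it; one more piece covers the remainder.
  greedy : ∀ r i → i ≤ d → Cuts Q (suc (r * 2)) i d ⊎ Seq (suc r) i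
  greedy r i i≤d with firstBad (d ∸ i) i i ≤-refl (m∸n+n≡m i≤d) (Q-refl i)
  ... | inj₁ q = inj₁ (cuts-pad Q-refl (s≤s z≤n) (cons i≤d q nil))
  greedy zero i i≤d | inj₂ (j , i≤j , j<d , q , c , h) = inj₂ (add c (m≤n⇒m≤1+n i≤j) j<d h [])
  greedy (suc r) i i≤d | inj₂ (j , i≤j , j<d , q , c , h) with greedy r (suc j) j<d
  ... | inj₁ cs = inj₁ (cons i≤j q (cons (n≤1+n j) (Q-step j j<d) cs))
  ... | inj₂ s = inj₂ (add c (m≤n⇒m≤1+n i≤j) j<d h s)

  cuts : Cuts Q (suc (k * k * 2)) 0 d
  cuts with greedy (k * k) 0 z≤n
  ... | inj₁ cs = cs
  ... | inj₂ s = ⊥-elim (no-long-seq s)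

-- After j + 1 rounds of doubling every concatenation of 2 ^ j basic pieces is found.
module Doubling
  {n} (G : Graph n) (B : Fin n → Fin n → ℕ → Set) (S : ℕ → Fin n → Fin n → Fin n → Set)
  (S-zero : ∀ {u v d} → ¬ S 0 u v d)
  (S-suc : ∀ {j u v d} → S (suc j) u v d ⇔
    (B u v (toℕ d) ⊎ ∃ λ w → ∃₂ λ p q → S j u w p × S j w v q × toℕ p + toℕ q ≡ toℕ d))
  (S? : ∀ j u v d → Dec (S j u v d))
  (B-sound : ∀ {u v l} → B u v l → Walk G u v l)
  where

  S-sound : ∀ j {u v d} → S j u v d → Walk G u v (toℕ d)
  S-sound zero s = ⊥-elim (S-zero s)
  S-sound (suc j) s with to S-suc s
  ... | inj₁ b = B-sound b
  ... | inj₂ (w , p , q , s₁ , s₂ , eq) = relen eq (S-sound j s₁ ⁀ S-sound j s₂)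

  module _ (P : ℕ → Fin n) where

    Basic : ℕ → ℕ → Set
    Basic i j = B (P i) (P j) (j ∸ i)

    -- The extra round produces the basic pieces themselves, since the iteration starts from the
    -- empty relation.
    cuts⇒S : ∀ r {i k} → Cuts Basic (2 ^ r) i k → ∀ d → toℕ d ≡ k ∸ i → S (suc r) (P i) (P k) d
    cuts⇒S zero (cons i≤j b nil) d eq = from S-suc (inj₁ (subst (B _ _) (sym eq) b))
    cuts⇒S (suc r) {i} {k} cs d eq with cuts-split (2 ^ r) cs
    ... | j , i≤j , cs₁ , cs₂ = from S-suc (inj₂ (P j , fromℕ< p<n , fromℕ< q<n ,
            cuts⇒S r cs₁ _ (toℕ-fromℕ< p<n) ,
            cuts⇒S r (subst (λ m → Cuts Basic m j k) (+-identityʳ (2 ^ r)) cs₂) _ (toℕ-fromℕ< q<n) ,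
            trans (cong₂ _+_ (toℕ-fromℕ< p<n) (toℕ-fromℕ< q<n)) (trans total (sym eq))))
      where
      j≤k : j ≤ k
      j≤k = cuts-≤ cs₂
      total : (j ∸ i) + (k ∸ j) ≡ k ∸ i
      total = trans (sym (+-∸-comm (k ∸ j) i≤j)) (cong (_∸ i) (m+[n∸m]≡n j≤k))
      -- The lengths of both halves must be domain elements; they are bounded by the total length,
      -- which is the domain element `d`.
      k∸i<n : k ∸ i < n
      k∸i<n = subst (_< n) eq (toℕ<n d)
      p<n : j ∸ i < n
      p<n = ≤-<-trans (∸-monoˡ-≤ i j≤k) k∸i<n
      q<n : k ∸ j < n
      q<n = ≤-<-trans (∸-monoʳ-≤ k i≤j) k∸i<n

  module _ (N : ℕ)
    (B-cuts : ∀ {u v d} (w : Walk G u v d) → (∀ l → Walk G u v l → d ≤ l) → d < n → Cuts (Basic (at w)) (2 ^ N) 0 d)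
    where

    S-complete : ∀ {u v d} → IsDist G u v d → S (suc N) u v d
    S-complete {d = d} (w , min) = subst₂ (λ x y → S (suc N) x y d) (at-start w) (at-end w)
      (cuts⇒S (at w) N (B-cuts w min (toℕ<n d)) d refl)

    -- `S` may also hold lengths of walks that are not shortest, so the least length is selected.
    -- The disjunction mirrors the implication in `minimalF`.
    minimal⇔isDist : ∀ {u v d} →
      (S (suc N) u v d × (∀ d' → ¬ S (suc N) u v d' ⊎ toℕ d ≤ toℕ d')) ⇔ IsDist G u v d
    minimal⇔isDist {u} {v} {d} = mk⇔ forth back
      where
      forth : S (suc N) u v d × (∀ d' → ¬ S (suc N) u v d' ⊎ toℕ d ≤ toℕ d') → IsDist G u v d
      forth (s , min) = S-sound (suc N) s , bound
        where
        bound : ∀ l → Walk G u v l → toℕ d ≤ l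
        bound l w with shortest w
        ... | l₀ , l₀≤l , dist with l₀ <? n
        -- The shortest length is at most that of the walk given by `s`, which is below `n`; hence
        -- `l₀` is a domain element to which `min` applies.
        ... | no ¬p = ⊥-elim (¬p (≤-<-trans (proj₂ dist _ (S-sound (suc N) s)) (toℕ<n d)))
        ... | yes l₀<n with min (fromℕ< l₀<n)
        ... | inj₁ ¬s = ⊥-elim (¬s (S-complete (subst (IsDistℕ G u v) (sym (toℕ-fromℕ< l₀<n)) dist)))
        ... | inj₂ d≤ = ≤-trans d≤ (≤-trans (≤-reflexive (toℕ-fromℕ< l₀<n)) l₀≤l)
      back : IsDist G u v d → S (suc N) u v d × (∀ d' → ¬ S (suc N) u v d' ⊎ toℕ d ≤ toℕ d')
      back dist = S-complete dist , λ d' → cmp d' (S? (suc N) u v d')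
        where
        cmp : ∀ d' → Dec (S (suc N) u v d') → ¬ S (suc N) u v d' ⊎ toℕ d ≤ toℕ d'
        cmp d' (yes s) = inj₂ (proj₂ dist _ (S-sound (suc N) s))
        cmp d' (no ¬s) = inj₁ ¬s

-- Pieces: new edges and old distances that survive the change

Through : ∀ {n} → Graph n → Graph n → Fin n → Fin n → ℕ → Set
Through G D u v l = ∃₂ λ a b → T (D a b) × T (G a b) × ∃₂ λ p q → Walk G u a p × Walk G b v q × p + suc q ≡ l

-- The search is finite because `p` is below `l` and `q` is then determined as `l ∸ suc p`.
through? : ∀ {n} (G D : Graph n) u v l → Dec (Through G D u v l)
through? G D u v l = any? λ a → any? λ b → T? (D a b) ×-dec T? (G a b) ×-dec lengths? a b
  where
  lengths? : ∀ a b → Dec (∃₂ λ p q → Walk G u a p × Walk G b v q × p + suc q ≡ l)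
  lengths? a b = map′
    (λ (p , w₁ , w₂) → toℕ p , l ∸ suc (toℕ p) , w₁ , w₂ ,
       trans (+-suc (toℕ p) _) (m+[n∸m]≡n (toℕ<n p)))
    (λ (p , q , w₁ , w₂ , eq) →
       let p<l = subst (p <_) eq (m<m+n p (s≤s z≤n))
           p≡ = toℕ-fromℕ< p<l
       in fromℕ< p<l , relen (sym p≡) w₁ ,
          relen (trans (sym (m+n∸m≡n (suc p) q))
            (cong₂ _∸_ (trans (sym (+-suc p q)) eq) (cong suc (sym p≡)))) w₂)
    (any? λ (p : Fin l) → walk? G u a (toℕ p) ×-dec walk? G b v (l ∸ suc (toℕ p)))

Old : Kind → ∀ {n} → Graph n → Graph n → Fin n → Fin n → ℕ → Set
Old ins G D u v l = IsDistℕ G u v l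
Old del G D u v l = IsDistℕ G u v l × ¬ Through G D u v l

Piece : Kind → ∀ {n} → Graph n → Graph n → Fin n → Fin n → ℕ → Set
Piece k G D u v l = (T (applyKind k G D u v) × l ≡ 1) ⊎ Old k G D u v l

ins-⊇ : ∀ {n} (G D : Graph n) → G ⊆ᴳ applyKind ins G D
ins-⊇ G D x y t = from T-∨ (inj₁ t)

ins-split : ∀ {n} (G D : Graph n) x y → T (applyKind ins G D x y) → T (G x y) ⊎ T (D x y)
ins-split G D x y t = to T-∨ t

del-⊆ : ∀ {n} (G D : Graph n) → applyKind del G D ⊆ᴳ G
del-⊆ G D x y t = proj₁ (to T-∧ t)

del-split : ∀ {n} (G D : Graph n) x y → T (G x y) → T (applyKind del G D x y) ⊎ T (D x y)
del-split G D x y t with T? (D x y)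
... | yes d = inj₂ d
... | no ¬d = inj₁ (from T-∧ (t , from T-not ¬d))

hit⇒through : ∀ {n} {G D : Graph n} {u v l} →
  (∃₂ λ a b → ∃₂ λ p q → Walk (applyKind del G D) u a p × T (G a b) × T (D a b) × Walk G b v q × p + suc q ≡ l) →
  Through G D u v l
hit⇒through {G = G} {D} (a , b , p , q , w₁ , g , d , w₂ , eq) = a , b , d , g , p , q , weaken (del-⊆ G D) w₁ , w₂ , eq

avoid : ∀ {n} {G D : Graph n} {u v l} → ¬ Through G D u v l → Walk G u v l → Walk (applyKind del G D) u v l
avoid {G = G} {D} ¬t w with firstHit {D = D} (del-split G D) w
... | inj₁ w' = w'
... | inj₂ h = ⊥-elim (¬t (hit⇒through h))

piece-sound : ∀ k {n} {G D : Graph n} {u v l} → Piece k G D u v l → Walk (applyKind k G D) u v l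
piece-sound k (inj₁ (e , refl)) = step e here
piece-sound ins {G = G} {D} (inj₂ (w , _)) = weaken (ins-⊇ G D) w
piece-sound del (inj₂ ((w , _) , ¬t)) = avoid ¬t w

piece-refl : ∀ k {n} {G D : Graph n} {u} → Piece k G D u u 0
piece-refl ins = inj₂ (here , λ _ _ → z≤n)
piece-refl del = inj₂ ((here , λ _ _ → z≤n) , λ { (_ , _ , _ , _ , p , q , _ , _ , eq) → 1+n≢0 (trans (sym (+-suc p q)) eq) })

module _ k {n} (G D : Graph n) {u v d} (w : Walk (applyKind k G D) u v d) where

  trivial-piece : ∀ i → Piece k G D (at w i) (at w i) (i ∸ i)
  trivial-piece i = subst (Piece k G D _ _) (sym (n∸n≡0 i)) (piece-refl k)

  edge-piece : ∀ i → i < d → Piece k G D (at w i) (at w (suc i)) (suc i ∸ i)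
  -- Once the length is rewritten to 1, the section can be matched as a single step.
  edge-piece i i<d with suc i ∸ i | m+n∸n≡m 1 i | section w i (suc i) (n≤1+n i) i<d
  ... | _ | refl | step e here = inj₁ (e , refl)

-- In dag mode the reversed pairs in L are superfluous, but one list serves both modes.
module Edges {n} (m : Mode) (Δ : List (Fin n × Fin n)) where

  D : Graph n
  D = changeG m Δ

  L : List (Fin n × Fin n)
  L = Δ ++ map swap Δ

  K : ℕ
  K = length L

  src tgt : Fin K → Fin n
  src e = proj₁ (List.lookup L e)
  tgt e = proj₂ (List.lookup L e)

  memb⇒∈ : ∀ x y (ps : List (Fin n × Fin n)) → T (memb x y ps) → (x , y) ∈ ps
  memb⇒∈ x y ((a , b) ∷ ps) t with to T-∨ t
  ... | inj₁ t' = let (t₁ , t₂) = to T-∧ t' in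
    here (cong₂ _,_ (toℕ-injective (≡ᵇ⇒≡ _ _ t₁)) (toℕ-injective (≡ᵇ⇒≡ _ _ t₂)))
  ... | inj₂ t' = there (memb⇒∈ x y ps t')

  D⇒∈ : ∀ m' {x y} → T (changeG m' Δ x y) → (x , y) ∈ L
  D⇒∈ undirected t with to T-∨ t
  ... | inj₁ t' = ∈-++⁺ˡ (memb⇒∈ _ _ Δ t')
  ... | inj₂ t' = ∈-++⁺ʳ Δ (∈-map⁺ swap (memb⇒∈ _ _ Δ t'))
  D⇒∈ dag t = ∈-++⁺ˡ (memb⇒∈ _ _ Δ t)

  edge-index : ∀ {x y} → T (D x y) → ∃ λ e → src e ≡ x × tgt e ≡ y
  edge-index t = let x∈L = D⇒∈ m t in
    Any.index x∈L , sym (cong proj₁ (lookup-index x∈L)) , sym (cong proj₂ (lookup-index x∈L))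

  K≤ : K ≤ 2 * length Δ
  K≤ = ≤-reflexive (trans (length-++ Δ) (cong (length Δ +_) (trans (length-map swap Δ) (sym (+-identityʳ _)))))

-- Symmetry persists because undirected changes are symmetrised; acyclicity is supplied by the
-- condition on allowed changes.
ModeInv : Mode → ∀ {n} → Graph n → Set
ModeInv undirected G = Symmetric G
ModeInv dag G = Acyclic G

changeG-sym : ∀ {n} (Δ : List (Fin n × Fin n)) → Symmetric (changeG undirected Δ)
changeG-sym Δ x y t with to (T-∨ {memb x y Δ} {memb y x Δ}) t
... | inj₁ a = from (T-∨ {memb y x Δ}) (inj₂ a)
... | inj₂ a = from (T-∨ {memb y x Δ}) (inj₁ a)

applyKind-sym : ∀ k {n} {G D : Graph n} → Symmetric G → Symmetric D → Symmetric (applyKind k G D)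
applyKind-sym ins sG sD x y t = from T-∨ (Sum.map (sG x y) (sD x y) (to T-∨ t))
applyKind-sym del sG sD x y t = let (a , b) = to T-∧ t in from T-∧ (sG x y a , from T-not (to T-not b ∘ sD y x))

applyG-inv : ∀ m {n} {G : Graph n} ch → ModeOK m (applyG m G ch) → ModeInv m G → ModeInv m (applyG m G ch)
applyG-inv undirected (k , Δ) _ sG = applyKind-sym k sG (changeG-sym Δ)
applyG-inv dag ch ok _ = ok

-- Colouring the bad intervals

module _ {n} (m : Mode) (Δ : List (Fin n × Fin n)) (G : Graph n) where
  open Edges m Δ

  module InsCuts {u v d} (w : Walk (applyKind ins G D) u v d) (min : ∀ l → Walk (applyKind ins G D) u v l → d ≤ l) where
    open ShortestWalk w min

    G' : Graph n
    G' = applyKind ins G D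

    -- The length `suc q` accounts for the inserted edge itself and is what makes the shortcut in
    -- `distinct` strict.
    Has : ℕ → ℕ → Fin K × Fin K → Set
    Has i j (e , _) = ∃₂ λ p q → Walk G' (at w i) (src e) p × Walk G' (src e) (at w j) (suc q) × i + (p + suc q) ≡ j

    -- A section without inserted edges is a walk of the old graph, and it is shortest there because
    -- every old walk is also a walk of the new graph.
    cover : ∀ i j → i ≤ j → j ≤ d → Piece ins G D (at w i) (at w j) (j ∸ i) ⊎ ∃ (Has i j)
    cover i j i≤j j≤d with lastHit {D = D} (ins-split G D) (section w i j i≤j j≤d)
    ... | inj₁ w' = inj₁ (inj₂ (w' , λ l w'' → proj₂ (section-isDist i j i≤j j≤d) l (weaken (ins-⊇ G D) w'')))
    ... | inj₂ (a , b , p , q , w₁ , h , t , w₂ , eq) with edge-index t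
    -- A single edge is coded as the pair `(e , e)`, so that the same count serves insertions and
    -- both kinds of deletion.
    ... | e , refl , refl = inj₂ ((e , e) , p , q , w₁ , step h (weaken (ins-⊇ G D) w₂) ,
            trans (cong (i +_) eq) (m+[n∸m]≡n i≤j))

    -- Skipping the detour between two uses of the same inserted edge shortens the walk.
    distinct : ∀ {i j i' j'} c → i ≤ j → j ≤ i' → i' ≤ j' → j' ≤ d → Has i j c → Has i' j' c → ⊥
    distinct {i} {j} {i'} {j'} c i≤j j≤i' i'≤j' j'≤d (p , q , w₁ , w₂ , eq) (p' , q' , w₁' , w₂' , eq') =
      <-irrefl refl (begin-strict
        j'                ≤⟨ gap i j' (≤-trans i≤j (≤-trans j≤i' i'≤j')) j'≤d (w₁ ⁀ w₂') ⟩
        i + (p + suc q')  ≡⟨ +-assoc i p (suc q') ⟨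
        (i + p) + suc q'  <⟨ +-monoˡ-< (suc q') (≤-trans (+-monoʳ-< i (m<m+n p (s≤s z≤n))) (≤-reflexive eq)) ⟩
        j + suc q'        ≤⟨ +-mono-≤ j≤i' (m≤n+m (suc q') p') ⟩
        i' + (p' + suc q') ≡⟨ eq' ⟩
        j'                ∎)
      where open ≤-Reasoning

    ins-cuts : Cuts (λ i j → Piece ins G D (at w i) (at w j) (j ∸ i)) (suc (K * K * 2)) 0 d
    ins-cuts = Cutting.cuts d K _ Has (trivial-piece ins G D w) (edge-piece ins G D w) cover distinct

  module DelCuts {u v d} (w : Walk (applyKind del G D) u v d) (min : ∀ l → Walk (applyKind del G D) u v l → d ≤ l) where
    open ShortestWalk w min

    G' : Graph n
    G' = applyKind del G D

    -- Let `l` be the old distance between the ends. If no old walk of length `l` meets the change,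
    -- such a walk survives, so the section has length `l` as well and is a piece. Otherwise the
    -- walk through the change provides the colour.
    del-cover : (Has : ℕ → ℕ → Fin K × Fin K → Set) →
      (∀ {i j l} → i + l ≤ j → Through G D (at w i) (at w j) l → ∃ (Has i j)) →
      ∀ i j → i ≤ j → j ≤ d → Piece del G D (at w i) (at w j) (j ∸ i) ⊎ ∃ (Has i j)
    del-cover Has colour i j i≤j j≤d with shortest (weaken (del-⊆ G D) (section w i j i≤j j≤d))
    ... | l , l≤ , dist with through? G D (at w i) (at w j) l
    ... | yes t = inj₂ (colour (≤-trans (+-monoʳ-≤ i l≤) (≤-reflexive (m+[n∸m]≡n i≤j))) t)
    ... | no ¬t = inj₁ (inj₂ (subst (λ x → IsDistℕ G (at w i) (at w j) x × ¬ Through G D (at w i) (at w j) x)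
            (≤-antisym l≤ (proj₂ (section-isDist i j i≤j j≤d) l (avoid ¬t (proj₁ dist)))) (dist , ¬t)))

    module Dag (acyclic : Acyclic G) where

      Has : ℕ → ℕ → Fin K × Fin K → Set
      Has i j (e , _) = ∃₂ λ p q → Walk G (at w i) (src e) p × Walk G (src e) (at w j) (suc q)

      colour : ∀ {i j l} → i + l ≤ j → Through G D (at w i) (at w j) l → ∃ (Has i j)
      colour _ (a , b , t , g , p , q , w₁ , w₂ , _) with edge-index t
      ... | e , refl , refl = (e , e) , p , q , w₁ , step g w₂

      -- The walk from `src e` to position `j`, the section of `w` up to `i'` and the walk back to
      -- `src e` form a closed walk of the old graph, of positive length because of `suc q`.
      distinct : ∀ {i j i' j'} c → i ≤ j → j ≤ i' → i' ≤ j' → j' ≤ d → Has i j c → Has i' j' c → ⊥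
      distinct (e , _) _ j≤i' i'≤j' j'≤d (_ , _ , _ , w₂) (_ , _ , w₁' , _) =
        acyclic (src e) _ (w₂ ⁀ weaken (del-⊆ G D) (section w _ _ j≤i' (≤-trans i'≤j' j'≤d)) ⁀ w₁')

    module Undirected (symmetric : Symmetric G') where

      -- The colour consists of the first and the last deleted edge of a shortest
      -- walk of G, so that its initial and final segments survive in G'.
      Has : ℕ → ℕ → Fin K × Fin K → Set
      Has i j (e , f) = ∃₂ λ p q → Walk G' (at w i) (src e) p × Walk G' (tgt f) (at w j) q × i + (p + suc q) ≤ j

      -- If the walk up to the given edge does not survive, it meets an earlier deleted edge, and
      -- the part before the first such edge survives and is shorter.
      initial : ∀ {x a b p} → Walk G x a p → T (D a b) → ∃ λ e → ∃ λ p' → Walk G' x (src e) p' × p' ≤ p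
      initial w t with firstHit {D = D} (del-split G D) w
      initial w t | inj₁ w' with edge-index t
      ... | e , refl , _ = e , _ , w' , ≤-refl
      initial w t | inj₂ (a , b , p , q , w₁ , _ , t' , _ , refl) with edge-index t'
      ... | e , refl , _ = e , p , w₁ , m≤m+n p (suc q)

      final : ∀ {a b y q} → Walk G b y q → T (D a b) → ∃ λ f → ∃ λ q' → Walk G' (tgt f) y q' × q' ≤ q
      final w t with lastHit {D = D} (del-split G D) w
      final w t | inj₁ w' with edge-index t
      ... | f , _ , refl = f , _ , w' , ≤-refl
      final w t | inj₂ (a , b , p , q , _ , _ , t' , w₂ , refl) with edge-index t'
      ... | f , _ , refl = f , q , w₂ , ≤-trans (n≤1+n q) (m≤n+m (suc q) p)

      colour : ∀ {i j l} → i + l ≤ j → Through G D (at w i) (at w j) l → ∃ (Has i j)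
      colour {i} i+l≤j (a , b , t , g , p , q , w₁ , w₂ , refl) =
        let (e , p' , w₁' , p'≤p) = initial w₁ t
            (f , q' , w₂' , q'≤q) = final w₂ t
        in (e , f) , p' , q' , w₁' , w₂' , ≤-trans (+-monoʳ-≤ i (+-mono-≤ p'≤p (s≤s q'≤q))) i+l≤j

      -- Walking from i to i' via the first edge and from j to j' via the last
      -- edge is shorter, in total, than following w.
      distinct : ∀ {i j i' j'} c → i ≤ j → j ≤ i' → i' ≤ j' → j' ≤ d → Has i j c → Has i' j' c → ⊥
      distinct {i} {j} {i'} {j'} c i≤j j≤i' i'≤j' j'≤d (p , q , w₁ , w₂ , h) (p' , q' , w₁' , w₂' , h') =
        -- Adding `h`, `h'`, `g₁` and `g₂` and cancelling common summands leaves
        -- `suc (j + j) ≤ j + j`; the surplus stems from the deleted edges counted in `h` and `h'`.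
        <-irrefl refl (+-cancelˡ-≤ (p + q + i + p' + q' + j') _ _ (begin
          (p + q + i + p' + q' + j') + suc (j + j) ≤⟨ +-monoʳ-≤ (p + q + i + p' + q' + j') (s≤s (+-mono-≤ j≤i' j≤i')) ⟩
          (p + q + i + p' + q' + j') + suc (i' + i') ≤⟨ n≤1+n _ ⟩
          suc ((p + q + i + p' + q' + j') + suc (i' + i')) ≡⟨ lhs p q p' q' i i' j' ⟩
          (i + (p + suc q)) + ((i' + (p' + suc q')) + (i' + j')) ≤⟨ +-mono-≤ h (+-mono-≤ h' (+-mono-≤ g₁ g₂)) ⟩
          j + (j' + ((i + (p + p')) + (j + (q + q')))) ≡⟨ rhs p q p' q' i j j' ⟩
          (p + q + i + p' + q' + j') + (j + j) ∎))
        where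
        open ≤-Reasoning
        g₁ : i' ≤ i + (p + p')
        g₁ = gap i i' (≤-trans i≤j j≤i') (≤-trans i'≤j' j'≤d) (w₁ ⁀ reverse symmetric w₁')
        g₂ : j' ≤ j + (q + q')
        g₂ = gap j j' (≤-trans j≤i' i'≤j') j'≤d (reverse symmetric w₂ ⁀ w₂')
        lhs : ∀ p q p' q' i i' j' → suc ((p + q + i + p' + q' + j') + suc (i' + i')) ≡
          (i + (p + suc q)) + ((i' + (p' + suc q')) + (i' + j'))
        lhs = solve-∀
        rhs : ∀ p q p' q' i j j' → j + (j' + ((i + (p + p')) + (j + (q + q')))) ≡
          (p + q + i + p' + q' + j') + (j + j)
        rhs = solve-∀

piece-cuts : ∀ m k {n} (Δ : List (Fin n × Fin n)) (G : Graph n) → ModeInv m G →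
  ∀ {u v d} (w : Walk (applyG m G (k , Δ)) u v d) → (∀ l → Walk (applyG m G (k , Δ)) u v l → d ≤ l) →
  let K = Edges.K m Δ in
  Cuts (λ i j → Piece k G (changeG m Δ) (at w i) (at w j) (j ∸ i)) (suc (K * K * 2)) 0 d
piece-cuts m ins Δ G inv w min = InsCuts.ins-cuts m Δ G w min
piece-cuts dag del Δ G inv w min = Cutting.cuts _ _ _ Has (trivial-piece del G (changeG dag Δ) w)
    (edge-piece del G (changeG dag Δ) w) (del-cover Has colour) distinct
  where
  open DelCuts dag Δ G w min
  open Dag inv
piece-cuts undirected del Δ G inv w min = Cutting.cuts _ _ _ Has (trivial-piece del G (changeG undirected Δ) w)
    (edge-piece del G (changeG undirected Δ) w) (del-cover Has colour) distinct
  where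
  open DelCuts undirected Δ G w min
  open Undirected (applyKind-sym del inv (changeG-sym Δ))

-- The number of rounds

-- Stated for an arbitrary accessibility proof because the recursion of `⌈log2⌉` runs along it.
n≤2^⌈log2⌉ : ∀ n (a : Acc _<_ n) → n ≤ 2 ^ ⌈log2⌉ n a
n≤2^⌈log2⌉ 0 _ = z≤n
n≤2^⌈log2⌉ 1 _ = s≤s z≤n
n≤2^⌈log2⌉ (suc (suc n)) (acc rs) = begin
  suc (suc n)                             ≡⟨ cong (λ h → suc (suc h)) (⌊n/2⌋+⌈n/2⌉≡n n) ⟨
  suc (suc (⌊ n /2⌋ + ⌈ n /2⌉))            ≤⟨ s≤s (s≤s (+-monoˡ-≤ ⌈ n /2⌉ (⌊n/2⌋≤⌈n/2⌉ n))) ⟩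
  suc (suc (⌈ n /2⌉ + ⌈ n /2⌉))            ≡⟨ double ⌈ n /2⌉ ⟩
  2 * suc ⌈ n /2⌉                          ≤⟨ *-monoʳ-≤ 2 (n≤2^⌈log2⌉ (suc ⌈ n /2⌉) _) ⟩
  2 * 2 ^ ⌈log2⌉ (suc ⌈ n /2⌉) _           ∎
  where
  open ≤-Reasoning
  double : ∀ h → suc (suc (h + h)) ≡ 2 * suc h
  double = solve-∀

-- Let `l = ⌈log₂ n ⌉` and `ll = ⌈log₂ l ⌉`. At most `2 * l ^ c` edges give at most
-- `2 ^ (2 * c * ll + 4)` pieces; with the initial round this takes `2 * c * ll + 5` rounds, which
-- is at most `(2 * c + 5) * (ll + 1)`.
rounds : ℕ → ℕ
rounds c = 2 * c + 5

enough-rounds : ∀ c n k → k ≤ 2 * ⌈log₂ n ⌉ ^ c →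
  ∃ λ N → iterations (rounds c) n ≡ suc N × suc (k * k * 2) ≤ 2 ^ N
enough-rounds c n k k≤ = N , count c ll , (begin
    suc (k * k * 2)         ≤⟨ s≤s (*-monoˡ-≤ 2 (*-mono-≤ k≤2^s k≤2^s)) ⟩
    1 + 2 ^ s * 2 ^ s * 2   ≡⟨ cong (λ x → 1 + x) (trans (*-comm (2 ^ s * 2 ^ s) 2) (cong (2 *_) (sym (^-distribˡ-+-* 2 s s)))) ⟩
    1 + 2 ^ suc (s + s)     ≤⟨ +-monoˡ-≤ (2 ^ suc (s + s)) (m^n>0 2 (suc (s + s))) ⟩
    2 ^ suc (s + s) + 2 ^ suc (s + s) ≡⟨ cong (2 ^ suc (s + s) +_) (+-identityʳ _) ⟨
    2 ^ suc (suc (s + s))   ≤⟨ ^-monoʳ-≤ 2 (m≤m+n (suc (suc (s + s))) (2 * c + 5 * ll)) ⟩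
    2 ^ N                   ∎)
  where
  open ≤-Reasoning
  l ll s N : ℕ
  l = ⌈log₂ n ⌉
  ll = ⌈log₂ l ⌉
  s = suc (ll * c)
  -- The last summand is slack that makes `suc N` equal to the prescribed number of rounds.
  N = suc (suc (s + s)) + (2 * c + 5 * ll)
  count : ∀ c ll → (2 * c + 5) * (ll + 1) ≡ suc (suc (suc (suc (ll * c) + suc (ll * c))) + (2 * c + 5 * ll))
  count = solve-∀
  k≤2^s : k ≤ 2 ^ s
  k≤2^s = begin
    k                 ≤⟨ k≤ ⟩
    2 * l ^ c         ≤⟨ *-monoʳ-≤ 2 (^-monoˡ-≤ c (n≤2^⌈log2⌉ l (<-wellFounded l))) ⟩
    2 * (2 ^ ll) ^ c  ≡⟨ cong (2 *_) (^-*-assoc 2 ll c) ⟩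
    2 ^ s             ∎

-- The dynamic program

Sym : Set
Sym = USym (voc []) 3

-- The numeral 1: `x * x = x` leaves 0 and 1, and `x + x ≠ x` excludes 0.
oneF : ∀ {S : Set} {ar : S → ℕ} {m} → Fin m → Formula S ar m
oneF x = andF (timesF x x x) (notF (plusF x x x))

one⇔ : ∀ k → (k * k ≡ k × ¬ (k + k ≡ k)) ⇔ k ≡ 1
one⇔ zero = mk⇔ (λ (_ , h) → ⊥-elim (h refl)) (λ ())
one⇔ (suc k) = mk⇔ (λ (h , _) → *-cancelˡ-≡ (suc k) 1 (suc k) (trans h (sym (*-identityʳ (suc k)))))
  (λ { refl → refl , λ () })

pattern 0F = zero
pattern 1F = suc 0F
pattern 2F = suc 1F
pattern 3F = suc 2F
pattern 4F = suc 3F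
pattern 5F = suc 4F
pattern 6F = suc 5F
pattern 7F = suc 6F
pattern 8F = suc 7F

dist : ∀ {m} → Fin m → Fin m → Fin m → Formula Sym uar m
dist u v d = rel (uAux zero) (u ∷ v ∷ d ∷ [])

iterated : ∀ {m} → Fin m → Fin m → Fin m → Formula Sym uar m
iterated u v d = rel uR (u ∷ v ∷ d ∷ [])

-- The bound variables are a, b, o, p, q, t from the outside in,
-- where o = dist(a,b) = 1, p = dist(u,a), q = dist(b,v), t = p + o and t + q = d.
throughF : Formula Sym uar 3
throughF = exF (exF (exF (exF (exF (exF
  (andF (rel uΔ (5F ∷ 4F ∷ []))
  (andF (andF (dist 5F 4F 3F) (oneF 3F))
  (andF (dist 6F 5F 2F)
  (andF (dist 4F 7F 1F)
  (andF (plusF 2F 3F 0F)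
        (plusF 0F 1F 8F)))))))))))

oldF : Kind → Formula Sym uar 3
oldF ins = dist 0F 1F 2F
oldF del = andF (dist 0F 1F 2F) (notF throughF)

pieceF : Kind → Formula Sym uar 3
pieceF k = orF (andF (rel uE (0F ∷ 1F ∷ [])) (oneF 2F)) (oldF k)

doubleF : Formula Sym uar 3
doubleF = exF (exF (exF (andF (iterated 3F 2F 1F) (andF (iterated 2F 4F 0F) (plusF 1F 0F 5F)))))

minimalF : Formula Sym uar 3
minimalF = andF (iterated 0F 1F 2F) (allF (orF (notF (iterated 1F 2F 0F)) (leqF 3F 0F)))

update : ℕ → Kind → Update (voc []) 3
update c k = record
  { iArity = 3
  ; iCount = rounds c
  ; stepF  = orF (pieceF k) doubleF
  ; finalF = minimalF
  }

program : ℕ → DynProg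
program c = record
  { rest  = []
  -- In the empty graph only the distances from a vertex to itself exist; `d + d = d` expresses
  -- `d = 0`.
  ; initF = λ { zero → andF (eqF 0F 1F) (plusF 2F 2F 2F) }
  ; insU  = λ { zero → update c ins }
  ; delU  = λ { zero → update c del }
  }

-- Correctness of the formulas and of one update

Correct : ∀ {n} → Graph n → AuxState (voc []) n → Set
Correct G A = ∀ u v d → T (A zero (u ∷ v ∷ d ∷ [])) ⇔ IsDist G u v d

module _ {n} {G D : Graph n} {A : AuxState (voc []) n} (correct : Correct G A) (G' : Graph n) (R : Rel n 3) where

  -- Since `d` is the distance, a walk of that length through `(a , b)` is shortest, and so are its
  -- parts before, on and after this edge; their lengths are at most `d`, hence domain elements
  -- recorded in `A`.
  throughF⇔ : ∀ {u v d} → IsDist G u v d → sat throughF (ustr G' D A R) (u ∷ v ∷ d ∷ []) ⇔ Through G D u v (toℕ d)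
  throughF⇔ {u} {v} {d} (w , min) = mk⇔ forth back
    where
    forth : sat throughF (ustr G' D A R) (u ∷ v ∷ d ∷ []) → Through G D u v (toℕ d)
    forth (a , b , o , p , q , t , δ , (ab , one) , ua , bv , eq₁ , eq₂)
      -- Update formulas see the edges of the new graph only; an edge of the old one is recovered
      -- from distance 1.
      with relen (to (one⇔ (toℕ o)) one) (proj₁ (to (correct a b o) ab))
    ... | step e here = a , b , δ , e , toℕ p , toℕ q , proj₁ (to (correct u a p) ua) , proj₁ (to (correct b v q) bv) ,
            trans (+-suc (toℕ p) (toℕ q))
              (trans (cong (_+ toℕ q) (trans (+-comm 1 (toℕ p)) (trans (cong (toℕ p +_) (sym (to (one⇔ (toℕ o)) one))) eq₁))) eq₂)
    back : Through G D u v (toℕ d) → sat throughF (ustr G' D A R) (u ∷ v ∷ d ∷ [])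
    back (a , b , δ , e , p , q , w₁ , w₂ , eq) =
      a , b , fin 1<n , fin p<n , fin q<n , fin t<n , δ ,
      (holds 1<n (isDistℕ-middle w₁ (step e here) w₂ (λ l w' → ≤-trans (≤-reflexive eq) (min l w'))) ,
       from (one⇔ _) (toℕ-fromℕ< 1<n)) ,
      holds p<n (isDistℕ-middle here w₁ (step e w₂) (λ l w' → ≤-trans (≤-reflexive eq) (min l w'))) ,
      holds q<n (isDistℕ-middle (w₁ ⁀ step e here) w₂ here (λ l w' → ≤-trans (≤-reflexive (trans (shift p q) eq)) (min l w'))) ,
      trans (cong₂ _+_ (toℕ-fromℕ< p<n) (toℕ-fromℕ< 1<n)) (sym (toℕ-fromℕ< t<n)) ,
      trans (cong₂ _+_ (toℕ-fromℕ< t<n) (toℕ-fromℕ< q<n)) (trans (+-assoc p 1 q) eq)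
      where
      shift : ∀ p q → (p + 1) + (q + 0) ≡ p + suc q
      shift = solve-∀
      bound : ∀ {x} → x ≤ p + suc q → x < n
      bound x≤ = ≤-<-trans x≤ (subst (_< n) (sym eq) (toℕ<n d))
      1<n : 1 < n
      1<n = bound (≤-trans (s≤s z≤n) (m≤n+m (suc q) p))
      p<n : p < n
      p<n = bound (m≤m+n p (suc q))
      q<n : q < n
      q<n = bound (≤-trans (n≤1+n q) (m≤n+m (suc q) p))
      t<n : p + 1 < n
      t<n = bound (+-monoʳ-≤ p (s≤s z≤n))
      fin : ∀ {x} → x < n → Fin n
      fin x<n = fromℕ< x<n
      holds : ∀ {x y l} (l<n : l < n) → IsDistℕ G x y l → T (A zero (x ∷ y ∷ fin l<n ∷ []))
      holds l<n dst = from (correct _ _ _) (subst (IsDistℕ G _ _) (sym (toℕ-fromℕ< l<n)) dst)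

  oldF⇔ : ∀ k {u v d} → sat (oldF k) (ustr G' D A R) (u ∷ v ∷ d ∷ []) ⇔ Old k G D u v (toℕ d)
  oldF⇔ ins {u} {v} {d} = correct u v d
  oldF⇔ del {u} {v} {d} = mk⇔
    (λ (a , ¬t) → let dst = to (correct u v d) a in dst , ¬t ∘ from (throughF⇔ dst))
    (λ (dst , ¬t) → from (correct u v d) dst , ¬t ∘ to (throughF⇔ dst))

module _ (c : ℕ) (m : Mode) (k : Kind) {n} (Δ : List (Fin n × Fin n)) (G : Graph n) (A : AuxState (voc []) n)
  (small : length Δ ≤ ⌈log₂ n ⌉ ^ c) (inv : ModeInv m G) (correct : Correct G A) where

  private
    D G' : Graph n
    D = changeG m Δ
    G' = applyG m G (k , Δ)

    R : ℕ → Rel n 3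
    R = iterate (update c k) G' D A

    S : ℕ → Fin n → Fin n → Fin n → Set
    S j u v d = T (R j (u ∷ v ∷ d ∷ []))

    S-suc : ∀ {j u v d} → S (suc j) u v d ⇔
      (Piece k G D u v (toℕ d) ⊎ ∃ λ w → ∃₂ λ p q → S j u w p × S j w v q × toℕ p + toℕ q ≡ toℕ d)
    S-suc {j} {u} {v} {d} = mk⇔ (forth ∘ to step⇔) (from step⇔ ∘ back)
      where
      Double : Set
      Double = ∃ λ w → ∃₂ λ p q → S j u w p × S j w v q × toℕ p + toℕ q ≡ toℕ d
      SatStep : Set
      SatStep = sat (orF (pieceF k) doubleF) (ustr G' D A (R j)) (u ∷ v ∷ d ∷ [])
      step⇔ : S (suc j) u v d ⇔ SatStep
      step⇔ = eval⇔sat (orF (pieceF k) doubleF) (ustr G' D A (R j)) (u ∷ v ∷ d ∷ [])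
      forth : SatStep → Piece k G D u v (toℕ d) ⊎ Double
      forth (inj₁ (inj₁ (e , one))) = inj₁ (inj₁ (e , to (one⇔ _) one))
      forth (inj₁ (inj₂ o)) = inj₁ (inj₂ (to (oldF⇔ correct G' (R j) k) o))
      forth (inj₂ dbl) = inj₂ dbl
      back : Piece k G D u v (toℕ d) ⊎ Double → SatStep
      back (inj₁ (inj₁ (e , eq))) = inj₁ (inj₁ (e , from (one⇔ _) eq))
      back (inj₁ (inj₂ o)) = inj₁ (inj₂ (from (oldF⇔ correct G' (R j) k) o))
      back (inj₂ dbl) = inj₂ dbl

  update-correct : ∀ u v d → T (runUpdate (update c k) G' D A (u ∷ v ∷ d ∷ [])) ⇔ IsDist G' u v d
  update-correct u v d
    with enough-rounds c n (Edges.K m Δ) (≤-trans (Edges.K≤ m Δ) (*-monoʳ-≤ 2 small))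
  ... | N , rounds≡ , enough = mk⇔ (to min⇔ ∘ to final⇔) (from final⇔ ∘ from min⇔)
    where
    Minimal : Set
    Minimal = S (suc N) u v d × (∀ d' → ¬ S (suc N) u v d' ⊎ toℕ d ≤ toℕ d')
    min⇔ : Minimal ⇔ IsDist G' u v d
    min⇔ = Doubling.minimal⇔isDist G' (Piece k G D) S (λ ()) (λ {j} → S-suc {j}) (λ j u v d → T? _) (piece-sound k) N
      (λ w min _ → cuts-pad (trivial-piece k G D w) enough (piece-cuts m k Δ G inv w min))
    final⇔ : T (runUpdate (update c k) G' D A (u ∷ v ∷ d ∷ [])) ⇔ Minimal
    final⇔ = subst (λ b → T b ⇔ Minimal)
      (sym (trans (runUpdate≡ (update c k) G' D A (u ∷ v ∷ d ∷ []))
        (cong (λ j → eval minimalF (ustr G' D A (R j)) (u ∷ v ∷ d ∷ [])) rounds≡)))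
      (eval⇔sat minimalF (ustr G' D A (R (suc N))) (u ∷ v ∷ d ∷ []))

-- Induction along the sequence of changes

empty-inv : ∀ m {n} → ModeInv m (emptyG {n})
empty-inv undirected _ _ ()
empty-inv dag _ _ (step () _)

module _ (m : Mode) (c : ℕ) where

  run-correct : ∀ {n} (G : Graph n) A (chs : List (Change n)) → AllowedFrom m c G chs → ModeInv m G → Correct G A →
    let (G' , A') = runP (program c) m (G , A) chs in Correct G' A'
  run-correct G A [] _ _ correct = correct
  run-correct G A ((ins , Δ) ∷ chs) (small , ok , allowed) inv correct =
    run-correct _ _ chs allowed (applyG-inv m (ins , Δ) ok inv) (update-correct c m ins Δ G A small inv correct)
  run-correct G A ((del , Δ) ∷ chs) (small , ok , allowed) inv correct =
    run-correct _ _ chs allowed (applyG-inv m (del , Δ) ok inv) (update-correct c m del Δ G A small inv correct)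

  init-correct : ∀ {n} → Correct {n} emptyG (proj₂ (initState (program c)))
  init-correct {n} u v d = mk⇔ (forth ∘ to init⇔) (from init⇔ ∘ back)
    where
    init⇔ = eval⇔sat (andF (eqF 0F 1F) (plusF 2F 2F 2F)) (istr emptyG) (u ∷ v ∷ d ∷ [])
    forth : toℕ u ≡ toℕ v × toℕ d + toℕ d ≡ toℕ d → IsDist emptyG u v d
    forth (eq , eq') with toℕ-injective eq
    ... | refl = relen (sym d≡0) here , λ _ _ → ≤-trans (≤-reflexive d≡0) z≤n
      where
      d≡0 : toℕ d ≡ 0
      d≡0 = +-cancelʳ-≡ (toℕ d) (toℕ d) 0 eq'
    back : IsDist emptyG u v d → toℕ u ≡ toℕ v × toℕ d + toℕ d ≡ toℕ d
    back (w , _) with toℕ d | w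
    ... | zero | here = refl , refl
    ... | suc _ | step () _

  program-maintains : MaintainsDist (program c) m c
  program-maintains n chs allowed = run-correct emptyG _ chs allowed (empty-inv m) init-correct

theorem6 : (∀ (c : ℕ) → Σ DynProg (λ P → MaintainsDist P undirected c))
    × (∀ (c : ℕ) → Σ DynProg (λ P → MaintainsDist P dag c))
theorem6 = (λ c → program c , program-maintains undirected c) , (λ c → program c , program-maintains dag c)
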